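{- Let $n,k$ be positive integers and let $z:[n]\to[k]$ be any map (a $k$-coloring). Let $\mathcal M_{n,z}:=\{\gamma\in\ker_{\mathbb Z}A_{n,z}:\ \|\gamma\|_1=4\}$. Then $\mathcal M_{n,z}$ is a Markov basis for $A_{n,z}$. Moreover, every nonzero $\gamma\in\ker_{\mathbb Z}A_{n,z}$ satisfies $\|\gamma\|_1\ge 4$, i.e. the elements of $\mathcal M_{n,z}$ are exactly the elements of $\ker_{\mathbb Z}A_{n,z}$ of minimal (nonzero) 1-norm.
   Context: Coordinates of $\mathbb Z^{\binom n2}$ are indexed by the 2-subsets $\{u,v\}$ of $[n]=\{1,\dots,n\}$; write $\gamma_{uv}=\gamma_{vu}$ for the coordinate of $\{u,v\}$. $D_n$ is the $n\times\binom n2$ vertex-edge incidence matrix of the complete graph $K_n$. $C_z$ is the $\binom{k+1}{2}\times\binom n2$ matrix with rows indexed by pairs $(i,j)$, $1\le i\le j\le k$, whose column indexed by $\{u,v\}$ has a single entry $1$, in the row $(\min(z(u),z(v)),\max(z(u),z(v)))$, and zeros elsewhere. $A_{n,z}$ is the matrix obtained by stacking $D_n$ on top of $C_z$. Thus $\gamma\in\ker_{\mathbb Z}A_{n,z}$ iff $\sum_{u\ne v}\gamma_{uv}=0$ for every vertex $v$ and, for all $1\le i\le j\le k$, the sum of $\gamma_{uv}$ over all $\{u,v\}$ with $\{z(u),z(v)\}=\{i,j\}$ is $0$. For an integer matrix $A$ with $c$ columns and a vector $b$, the fiber is $\mathcal F_A(b)=\{x\in\mathbb N^c: Ax=b\}$.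 A finite set $\mathcal B\subset\ker_{\mathbb Z}A$ is a Markov basis for $A$ if for every $b$ the graph with vertex set $\mathcal F_A(b)$, in which $x,x'$ are adjacent iff $x-x'\in\mathcal B\cup(-\mathcal B)$, is connected. -}

module Defs where

open import Data.Nat using (ℕ; zero; suc)
open import Data.Integer as ℤ using (ℤ; +_; -_; ∣_∣)
open import Data.Fin as Fin using (Fin; toℕ; inject≤)
open import Data.Fin.Properties using (toℕ≤n; _≟_)
open import Data.Product using (Σ; ∃; _×_; _,_; proj₁; proj₂)
open import Data.Sum using (_⊎_)
open import Data.List using (List)
open import Data.List.Membership.Propositional using (_∈_)
open import Data.Bool using (Bool; true; false; if_then_else_; _∧_)
open import Relation.Nullary using (¬_)
open import Relation.Nullary.Decidable using (⌊_⌋)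
open import Relation.Binary.PropositionalEquality using (_≡_)

sumFinℤ : (m : ℕ) → (Fin m → ℤ) → ℤ
sumFinℤ zero    f = + 0
sumFinℤ (suc m) f = f Fin.zero ℤ.+ sumFinℤ m (λ i → f (Fin.suc i))

sumFinℕ : (m : ℕ) → (Fin m → ℕ) → ℕ
sumFinℕ zero    f = 0
sumFinℕ (suc m) f = f Fin.zero Data.Nat.+ sumFinℕ m (λ i → f (Fin.suc i))

-- Edges of K_n: the 2-subsets {u,v} of [n] = Fin n, encoded uniquely as
-- a pair (v , u) with u < v, i.e. u : Fin (toℕ v).

Edge : ℕ → Set
Edge n = Σ (Fin n) (λ v → Fin (toℕ v))

hi : ∀ {n} → Edge n → Fin n
hi (v , u) = v

lo : ∀ {n} → Edge n → Fin n
lo (v , u) = inject≤ u (toℕ≤n v)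

sumEdgeℤ : (n : ℕ) → (Edge n → ℤ) → ℤ
sumEdgeℤ n f = sumFinℤ n (λ v → sumFinℤ (toℕ v) (λ u → f (v , u)))

sumEdgeℕ : (n : ℕ) → (Edge n → ℕ) → ℕ
sumEdgeℕ n f = sumFinℕ n (λ v → sumFinℕ (toℕ v) (λ u → f (v , u)))

Vecℤ : ℕ → Set
Vecℤ n = Edge n → ℤ

Vecℕ : ℕ → Set
Vecℕ n = Edge n → ℕ

norm₁ : ∀ {n} → Vecℤ n → ℕ
norm₁ {n} γ = sumEdgeℕ n (λ e → ∣ γ e ∣)

-- The matrix A_{n,z} = (D_n ; C_z) acting on integer vectors.

incident : ∀ {n} → Fin n → Edge n → Bool
incident w e = ⌊ w ≟ lo e ⌋ Data.Bool.∨ ⌊ w ≟ hi e ⌋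

Dmul : ∀ {n} → Vecℤ n → Fin n → ℤ
Dmul {n} γ w = sumEdgeℤ n (λ e → if incident w e then γ e else + 0)

colourRow : ∀ {n k} → (Fin n → Fin k) → Fin k → Fin k → Edge n → Bool
colourRow z i j e =
  (⌊ z (lo e) ≟ i ⌋ ∧ ⌊ z (hi e) ≟ j ⌋) Data.Bool.∨
  (⌊ z (lo e) ≟ j ⌋ ∧ ⌊ z (hi e) ≟ i ⌋)

-- row (i , j) of C_z applied to γ (the row exists for i ≤ j)
Cmul : ∀ {n k} → (Fin n → Fin k) → Vecℤ n → Fin k → Fin k → ℤ
Cmul {n} z γ i j = sumEdgeℤ n (λ e → if colourRow z i j e then γ e else + 0)

-- a right-hand side b ∈ ℤ^{n + binom(k+1,2)}: a D-part and a C-part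
-- (the C-part indexed by pairs i ≤ j)
RHS : ℕ → ℕ → Set
RHS n k = (Fin n → ℤ) × ((i j : Fin k) → i Fin.≤ j → ℤ)

AEq : ∀ {n k} → (Fin n → Fin k) → Vecℤ n → RHS n k → Set
AEq {n} {k} z γ b =
  (∀ w → Dmul γ w ≡ proj₁ b w) ×
  (∀ (i j : Fin k) (i≤j : i Fin.≤ j) → Cmul z γ i j ≡ proj₂ b i j i≤j)

zeroRHS : ∀ {n k} → RHS n k
zeroRHS = (λ _ → + 0) , (λ _ _ _ → + 0)

InKernel : ∀ {n k} → (Fin n → Fin k) → Vecℤ n → Set
InKernel z γ = AEq z γ zeroRHS

toℤ : ∀ {n} → Vecℕ n → Vecℤ n
toℤ x e = + (x e)

InFiber : ∀ {n k} → (Fin n → Fin k) → RHS n k → Vecℕ n → Set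
InFiber z b x = AEq z (toℤ x) b

diff : ∀ {n} → Vecℕ n → Vecℕ n → Vecℤ n
diff x x' e = + (x e) ℤ.- + (x' e)

_≗ᵥ_ : ∀ {A : Set} {n} → (Edge n → A) → (Edge n → A) → Set
f ≗ᵥ g = ∀ e → f e ≡ g e

VSet : ℕ → Set₁
VSet n = Vecℤ n → Set

Adjacent : ∀ {n} → VSet n → Vecℕ n → Vecℕ n → Set
Adjacent B x x' = B (diff x x') ⊎ B (λ e → - diff x x' e)

data Walk {n k} (z : Fin n → Fin k) (b : RHS n k) (B : VSet n)
          : Vecℕ n → Vecℕ n → Set where
  here : ∀ {x y} → x ≗ᵥ y → Walk z b B x y
  step : ∀ {x y w} → InFiber z b y → Adjacent B x y →
         Walk z b B y w → Walk z b B x w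

FiniteVSet : ∀ {n} → VSet n → Set
FiniteVSet {n} B =
  Σ (List (Vecℤ n)) λ L →
    ∀ γ → (B γ → Σ (Vecℤ n) λ γ' → (γ' ∈ L) × (γ ≗ᵥ γ')) ×
          (∀ γ' → γ' ∈ L → γ ≗ᵥ γ' → B γ)

IsMarkovBasis : ∀ {n k} → (Fin n → Fin k) → VSet n → Set
IsMarkovBasis {n} {k} z B =
  FiniteVSet B ×
  (∀ γ → B γ → InKernel z γ) ×
  (∀ (b : RHS n k) (x y : Vecℕ n) →
     InFiber z b x → InFiber z b y → Walk z b B x y)

M : ∀ {n k} → (Fin n → Fin k) → VSet n
M z γ = InKernel z γ × (norm₁ γ ≡ 4)

{-# OPTIONS --safe #-}

-- A vector of ℕ^E is a loopless multigraph, and two of them lie in one fiber when they agree in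
-- degrees and in the number of edges between any two colour classes. If b and c have the same
-- colour, replacing edges ac, bq by ab, cq stays in the fiber, and costs norm at most 4.
-- Given x and y in one fiber with ab in y, the colour counts provide a′b′ in x with a′, b′ coloured
-- like a, b. At most one exchange in x or y turns this into a pair of edges with a common endpoint,
-- and one more into a common edge; whenever loops obstruct an exchange in x, either the exchange
-- in y is possible or the obstructing edges coincide. Removing the common edge, induct on the
-- number of edges. The minimal norm is 4 because the positive and the negative part of a kernel
-- vector are edge-disjoint multigraphs with equal degrees, so that each has two distinct edges;
-- hence an exchange which changes anything has norm exactly 4.
module Submission where

open import Defs
open import Data.Nat using (ℕ; _≤_; NonZero)
open import Data.Integer using (ℤ; +_)
open import Data.Fin using (Fin)
open import Data.Product using (_×_)
open import Relation.Nullary using (¬_)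
open import Relation.Binary.PropositionalEquality using (_≡_)

open import Algebra.Properties.CommutativeSemigroup using (interchange)
open import Data.Bool using (Bool; true; false; if_then_else_; _∧_; _∨_)
open import Data.Bool.Properties using (∨-comm; ∧-comm)
open import Data.Empty using (⊥)
open import Data.Fin as Fin using (toℕ; fromℕ<)
open import Data.Fin.Properties as Finₚ using (_≟_; toℕ≤n; toℕ-inject≤; toℕ-fromℕ<; toℕ-injective; toℕ<n; all?)
open import Data.Integer as ℤ using (-[1+_]; -_; ∣_∣)
import Data.Integer.Properties as ℤₚ
open import Data.List using (List; []; _∷_; _++_; map; upTo; cartesianProductWith; filter)
open import Data.List.Membership.Propositional using (_∈_)
open import Data.List.Membership.Propositional.Properties
  using (∈-cartesianProductWith⁺; ∈-filter⁺; ∈-filter⁻; ∈-++⁺ˡ; ∈-++⁺ʳ; ∈-map⁺; ∈-upTo⁺)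
open import Data.List.Relation.Unary.Any using (here)
open import Data.Nat using (zero; suc; _+_; _∸_; _<_; z≤n; s≤s; z<s)
open import Data.Nat.Properties as ℕₚ
  using (≤-refl; ≤-reflexive; ≤-trans; <-cmp; m≤m+n; +-mono-≤; +-comm; +-assoc; +-cancelˡ-≡; suc-injective;
         +-identityʳ; n≢0⇒n>0; n≤0⇒n≡0; m+[n∸m]≡n; module ≤-Reasoning)
open import Data.Product using (swap; ∃₂; ∃-syntax; _,_; proj₁; proj₂)
open import Data.Product.Properties using (≡-dec)
open import Data.Sum using (_⊎_; inj₁; inj₂)
open import Function using (_∘_)
open import Relation.Binary using (Symmetric; tri<; tri≈; tri>)
open import Relation.Binary.Construct.Closure.ReflexiveTransitive using (Star; ε; _◅_; _◅◅_; reverse; gmap)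
open import Relation.Binary.PropositionalEquality
  using (_≢_; refl; sym; trans; cong; cong₂; subst; subst₂; module ≡-Reasoning)
open import Relation.Nullary using (Dec; yes; no; contradiction)
open import Relation.Nullary.Decidable using (⌊_⌋; _×-dec_; _→-dec_)
open import Relation.Unary using (Decidable)

variable
  n k : ℕ

-- Finite sums

sumFinℕ-cong : ∀ m {f g : Fin m → ℕ} → (∀ i → f i ≡ g i) → sumFinℕ m f ≡ sumFinℕ m g
sumFinℕ-cong zero    eq = refl
sumFinℕ-cong (suc m) eq = cong₂ _+_ (eq Fin.zero) (sumFinℕ-cong m (eq ∘ Fin.suc))

sumFinℤ-cong : ∀ m {f g : Fin m → ℤ} → (∀ i → f i ≡ g i) → sumFinℤ m f ≡ sumFinℤ m g
sumFinℤ-cong zero    eq = refl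
sumFinℤ-cong (suc m) eq = cong₂ ℤ._+_ (eq Fin.zero) (sumFinℤ-cong m (eq ∘ Fin.suc))

sumFinℕ-mono : ∀ m {f g : Fin m → ℕ} → (∀ i → f i ≤ g i) → sumFinℕ m f ≤ sumFinℕ m g
sumFinℕ-mono zero    le = z≤n
sumFinℕ-mono (suc m) le = +-mono-≤ (le Fin.zero) (sumFinℕ-mono m (le ∘ Fin.suc))

sumFinℕ-+ : ∀ m (f g : Fin m → ℕ) → sumFinℕ m (λ i → f i + g i) ≡ sumFinℕ m f + sumFinℕ m g
sumFinℕ-+ zero    f g = refl
sumFinℕ-+ (suc m) f g =
  trans (cong₂ _+_ refl (sumFinℕ-+ m (f ∘ Fin.suc) (g ∘ Fin.suc)))
        (interchange ℕₚ.+-commutativeSemigroup (f Fin.zero) _ _ _)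

sumFinℕ-zero : ∀ m {f : Fin m → ℕ} → (∀ i → f i ≡ 0) → sumFinℕ m f ≡ 0
sumFinℕ-zero zero    eq = refl
sumFinℕ-zero (suc m) eq = cong₂ _+_ (eq Fin.zero) (sumFinℕ-zero m (eq ∘ Fin.suc))

sumFinℕ-single : ∀ m {f : Fin m → ℕ} i → (∀ j → j ≢ i → f j ≡ 0) → sumFinℕ m f ≡ f i
sumFinℕ-single (suc m) Fin.zero eq =
  trans (cong₂ _+_ refl (sumFinℕ-zero m (λ j → eq (Fin.suc j) λ ()))) (+-identityʳ _)
sumFinℕ-single (suc m) (Fin.suc i) eq =
  cong₂ _+_ (eq Fin.zero λ ()) (sumFinℕ-single m i (λ j j≢i → eq (Fin.suc j) (j≢i ∘ Finₚ.suc-injective)))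

sumFinℕ-pos : ∀ m {f : Fin m → ℕ} → 0 < sumFinℕ m f → ∃[ i ] 0 < f i
sumFinℕ-pos (suc m) {f} pos with f Fin.zero in eq
... | suc _ = Fin.zero , subst (0 <_) (sym eq) z<s
... | zero with i , p ← sumFinℕ-pos m pos = Fin.suc i , p

-- The bridge from integer sums to counting: once a vector is a difference of two multigraphs, its
-- rows can be compared in `ℕ`.
sumFinℤ-pos-neg : ∀ m (f g : Fin m → ℕ) →
  sumFinℤ m (λ i → + f i ℤ.- + g i) ≡ + sumFinℕ m f ℤ.- + sumFinℕ m g
sumFinℤ-pos-neg zero    f g = refl
sumFinℤ-pos-neg (suc m) f g = begin
  (+ a ℤ.- + b) ℤ.+ sumFinℤ m _         ≡⟨ cong (λ i → (+ a ℤ.- + b) ℤ.+ i) (sumFinℤ-pos-neg m (f ∘ Fin.suc) (g ∘ Fin.suc)) ⟩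
  (+ a ℤ.- + b) ℤ.+ (+ s ℤ.- + t)       ≡⟨ interchange ℤₚ.+-commutativeSemigroup (+ a) (- + b) (+ s) (- + t) ⟩
  (+ a ℤ.+ + s) ℤ.+ (- + b ℤ.+ - + t)   ≡⟨ cong (λ i → (+ a ℤ.+ + s) ℤ.+ i) (ℤₚ.neg-distrib-+ (+ b) (+ t)) ⟨
  + (a + s) ℤ.- + (b + t)               ∎
  where
  open ≡-Reasoning
  a = f Fin.zero
  b = g Fin.zero
  s = sumFinℕ m (f ∘ Fin.suc)
  t = sumFinℕ m (g ∘ Fin.suc)

-- Sums over the edges selected by a Boolean mask

keep : Bool → ℕ → ℕ
keep b m = if b then m else 0

-- Degrees, colour counts and the number of edges differ only in the mask `P`, so each fact about
-- `mass` serves all three.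
mass : (Edge n → Bool) → Vecℕ n → ℕ
mass {n} P x = sumEdgeℕ n (λ e → keep (P e) (x e))

everywhere : Edge n → Bool
everywhere _ = true

total : Vecℕ n → ℕ
total = mass everywhere

infixl 6 _⊕_
_⊕_ : Vecℕ n → Vecℕ n → Vecℕ n
(x ⊕ y) e = x e + y e

_≟ₑ_ : (e f : Edge n) → Dec (e ≡ f)
_≟ₑ_ = ≡-dec _≟_ _≟_

δ : Edge n → Vecℕ n
δ f e = keep ⌊ e ≟ₑ f ⌋ 1

δ-self : (f : Edge n) → δ f f ≡ 1
δ-self f with f ≟ₑ f
... | yes _  = refl
... | no f≢f = contradiction refl f≢f

δ-other : {e f : Edge n} → e ≢ f → δ f e ≡ 0
δ-other {e = e} {f} e≢f with e ≟ₑ f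
... | yes e≡f = contradiction e≡f e≢f
... | no _    = refl

sumEdgeℕ-cong : {x y : Vecℕ n} → x ≗ᵥ y → sumEdgeℕ n x ≡ sumEdgeℕ n y
sumEdgeℕ-cong eq = sumFinℕ-cong _ λ v → sumFinℕ-cong _ λ u → eq (v , u)

sumEdgeℤ-cong : {x y : Vecℤ n} → x ≗ᵥ y → sumEdgeℤ n x ≡ sumEdgeℤ n y
sumEdgeℤ-cong eq = sumFinℤ-cong _ λ v → sumFinℤ-cong _ λ u → eq (v , u)

sumEdgeℕ-mono : {x y : Vecℕ n} → (∀ e → x e ≤ y e) → sumEdgeℕ n x ≤ sumEdgeℕ n y
sumEdgeℕ-mono le = sumFinℕ-mono _ λ v → sumFinℕ-mono _ λ u → le (v , u)

row : Vecℕ n → Fin n → ℕ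
row x v = sumFinℕ (toℕ v) (λ u → x (v , u))

sumEdgeℕ-+ : (x y : Vecℕ n) → sumEdgeℕ n (x ⊕ y) ≡ sumEdgeℕ n x + sumEdgeℕ n y
sumEdgeℕ-+ {n} x y = trans
  (sumFinℕ-cong n λ v → sumFinℕ-+ (toℕ v) (λ u → x (v , u)) (λ u → y (v , u)))
  (sumFinℕ-+ n (row x) (row y))

sumEdgeℕ-single : {x : Vecℕ n} (f : Edge n) → (∀ e → e ≢ f → x e ≡ 0) → sumEdgeℕ n x ≡ x f
sumEdgeℕ-single (v , u) eq = trans
  (sumFinℕ-single _ v λ w w≢v → sumFinℕ-zero _ λ t → eq (w , t) (w≢v ∘ cong proj₁))
  (sumFinℕ-single _ u λ t t≢u → eq (v , t) λ { refl → t≢u refl })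

sumEdgeℕ-pos : {x : Vecℕ n} → 0 < sumEdgeℕ n x → ∃[ e ] 0 < x e
sumEdgeℕ-pos pos with v , p ← sumFinℕ-pos _ pos with u , q ← sumFinℕ-pos _ p = (v , u) , q

sumEdgeℤ-pos-neg : (x y : Vecℕ n) → sumEdgeℤ n (diff x y) ≡ + sumEdgeℕ n x ℤ.- + sumEdgeℕ n y
sumEdgeℤ-pos-neg {n} x y = trans
  (sumFinℤ-cong n λ v → sumFinℤ-pos-neg (toℕ v) (λ u → x (v , u)) (λ u → y (v , u)))
  (sumFinℤ-pos-neg n (row x) (row y))

mass-cong : (P : Edge n → Bool) {x y : Vecℕ n} → x ≗ᵥ y → mass P x ≡ mass P y
mass-cong P eq = sumEdgeℕ-cong λ e → cong (keep (P e)) (eq e)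

keep-+ : ∀ b l m → keep b (l + m) ≡ keep b l + keep b m
keep-+ true  l m = refl
keep-+ false l m = refl

keep-0 : ∀ b → keep b 0 ≡ 0
keep-0 true  = refl
keep-0 false = refl

mass-⊕ : (P : Edge n → Bool) (x y : Vecℕ n) → mass P (x ⊕ y) ≡ mass P x + mass P y
mass-⊕ P x y = trans (sumEdgeℕ-cong λ e → keep-+ (P e) (x e) (y e))
  (sumEdgeℕ-+ (λ e → keep (P e) (x e)) (λ e → keep (P e) (y e)))

mass-δ : (P : Edge n → Bool) (f : Edge n) → mass P (δ f) ≡ keep (P f) 1
mass-δ P f = trans
  (sumEdgeℕ-single f λ e e≢f → trans (cong (keep (P e)) (δ-other e≢f)) (keep-0 (P e)))
  (cong (keep (P f)) (δ-self f))

-- Matching on an existential result normalises its proof, hence abstract here and below.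
abstract
  mass-pos : (P : Edge n → Bool) {x : Vecℕ n} → 0 < mass P x → ∃[ e ] P e ≡ true × 0 < x e
  mass-pos P pos with e , p ← sumEdgeℕ-pos pos with P e in eq
  ... | true = e , eq , p

abstract
  remove : {x : Vecℕ n} (f : Edge n) → 0 < x f → ∃[ r ] x ≗ᵥ (δ f ⊕ r)
  -- Truncated subtraction loses nothing, since `δ f` is at most `x` at every edge.
  remove {x = x} f pos = (λ e → x e ∸ δ f e) , λ e → sym (m+[n∸m]≡n (δ≤ e))
    where
    δ≤ : ∀ e → δ f e ≤ x e
    δ≤ e with e ≟ₑ f
    ... | yes refl = pos
    ... | no _     = z≤n

mass-remove : (P : Edge n → Bool) {x r : Vecℕ n} (f : Edge n) → x ≗ᵥ (δ f ⊕ r) →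
  mass P x ≡ keep (P f) 1 + mass P r
mass-remove P f eq = trans (mass-cong P eq) (trans (mass-⊕ P _ _) (cong (_+ _) (mass-δ P f)))

pos-mass : (P : Edge n → Bool) {x : Vecℕ n} (f : Edge n) → P f ≡ true → 0 < x f → 0 < mass P x
pos-mass P f Pf pos with r , eq ← remove f pos =
  subst (0 <_) (sym (trans (mass-remove P f eq) (cong (λ b → keep b 1 + mass P r) Pf))) z<s

abstract
  -- Taking out one copy of `f` leaves the multiplicity of `g` unchanged because the edges differ,
  -- so `remove` applies a second time.
  remove₂ : {x : Vecℕ n} {f g : Edge n} → f ≢ g → 0 < x f → 0 < x g → ∃[ r ] x ≗ᵥ (δ f ⊕ δ g ⊕ r)
  remove₂ {x = x} {f} {g} f≢g xf xg with r , eq ← remove f xf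
    with s , eq′ ← remove {x = r} g (subst (0 <_) (trans (eq g) (cong (_+ r g) (δ-other (f≢g ∘ sym)))) xg) =
    s , λ e → trans (eq e) (trans (cong₂ _+_ refl (eq′ e)) (sym (+-assoc (δ f e) _ _)))

mass-⊕₃ : (P : Edge n → Bool) (f g : Edge n) (r : Vecℕ n) →
  mass P (δ f ⊕ δ g ⊕ r) ≡ keep (P f) 1 + keep (P g) 1 + mass P r
mass-⊕₃ P f g r = trans (mass-⊕ P _ r)
  (cong (_+ mass P r) (trans (mass-⊕ P _ _) (cong₂ _+_ (mass-δ P f) (mass-δ P g))))

2≤total : {x : Vecℕ n} {f g : Edge n} → f ≢ g → 0 < x f → 0 < x g → 2 ≤ total x
2≤total {f = f} {g} f≢g xf xg with r , eq ← remove₂ f≢g xf xg =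
  subst (2 ≤_) (sym (trans (mass-cong everywhere eq) (mass-⊕₃ everywhere f g r))) (m≤m+n 2 _)

entry≤total : (x : Vecℕ n) (e : Edge n) → x e ≤ total x
entry≤total x e = begin
  x e                        ≡⟨ only-self ⟨
  keep ⌊ e ≟ₑ e ⌋ (x e)      ≡⟨ sumEdgeℕ-single e only-e ⟨
  sumEdgeℕ _ restricted      ≤⟨ sumEdgeℕ-mono restricted≤ ⟩
  total x                    ∎
  where
  open ≤-Reasoning
  restricted : Vecℕ _
  restricted f = keep ⌊ f ≟ₑ e ⌋ (x f)
  restricted≤ : ∀ f → restricted f ≤ x f
  restricted≤ f with f ≟ₑ e
  ... | yes _ = ≤-refl
  ... | no _  = z≤n
  only-e : ∀ f → f ≢ e → restricted f ≡ 0
  only-e f f≢e with f ≟ₑ e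
  ... | yes f≡e = contradiction f≡e f≢e
  ... | no _    = refl
  only-self : restricted e ≡ x e
  only-self with e ≟ₑ e
  ... | yes _  = refl
  ... | no e≢e = contradiction refl e≢e

-- Edges as unordered pairs

-- An `Edge` is stored with its smaller end first, while an exchange treats both ends alike; this
-- relation forgets the order.
data Joins (e : Edge n) (u v : Fin n) : Set where
  forward  : lo e ≡ u → hi e ≡ v → Joins e u v
  backward : lo e ≡ v → hi e ≡ u → Joins e u v

toℕ-lo<hi : (e : Edge n) → toℕ (lo e) < toℕ (hi e)
toℕ-lo<hi (v , u) = subst (_< toℕ v) (sym (toℕ-inject≤ u (toℕ≤n v))) (toℕ<n u)

lo≢hi : (e : Edge n) → lo e ≢ hi e
lo≢hi e eq = ℕₚ.<⇒≢ (toℕ-lo<hi e) (cong toℕ eq)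

joins-sym : {e : Edge n} {u v : Fin n} → Joins e u v → Joins e v u
joins-sym (forward p q)  = backward p q
joins-sym (backward p q) = forward p q

joins-≢ : {e : Edge n} {u v : Fin n} → Joins e u v → u ≢ v
joins-≢ {e = e} (forward refl refl) eq = lo≢hi e eq
joins-≢ {e = e} (backward refl refl) eq = lo≢hi e (sym eq)

edge-ext : {e f : Edge n} → lo e ≡ lo f → hi e ≡ hi f → e ≡ f
edge-ext {e = v , u} {.v , u′} eq refl = cong (v ,_) (toℕ-injective
  (trans (sym (toℕ-inject≤ u (toℕ≤n v))) (trans (cong toℕ eq) (toℕ-inject≤ u′ (toℕ≤n v)))))

-- With opposite orientations the same two vertices would be ordered both ways by `toℕ-lo<hi`; with
-- equal orientations `edge-ext` applies.
joins-unique : {e f : Edge n} {u v : Fin n} → Joins e u v → Joins f u v → e ≡ f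
joins-unique (forward p q) (forward r s) = edge-ext (trans p (sym r)) (trans q (sym s))
joins-unique (backward p q) (backward r s) = edge-ext (trans p (sym r)) (trans q (sym s))
joins-unique {e = e} {f} (forward refl refl) (backward r s) =
  contradiction (subst₂ (λ a b → toℕ a < toℕ b) r s (toℕ-lo<hi f)) (ℕₚ.<-asym (toℕ-lo<hi e))
joins-unique {e = e} {f} (backward refl refl) (forward r s) =
  contradiction (subst₂ (λ a b → toℕ a < toℕ b) r s (toℕ-lo<hi f)) (ℕₚ.<-asym (toℕ-lo<hi e))

joins-apart : {e f : Edge n} {u v w t : Fin n} → Joins e u v → Joins f w t → w ≢ u → w ≢ v → e ≢ f
joins-apart (forward p q) (forward r s) w≢u w≢v refl = w≢u (trans (sym r) p)
joins-apart (forward p q) (backward r s) w≢u w≢v refl = w≢v (trans (sym s) q)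
joins-apart (backward p q) (forward r s) w≢u w≢v refl = w≢v (trans (sym r) p)
joins-apart (backward p q) (backward r s) w≢u w≢v refl = w≢u (trans (sym s) q)

edge : (u v : Fin n) → u ≢ v → ∃[ e ] Joins e u v
edge u v u≢v with <-cmp (toℕ u) (toℕ v)
... | tri< u<v _ _ = (v , fromℕ< u<v) ,
  forward (toℕ-injective (trans (toℕ-inject≤ _ (toℕ≤n v)) (toℕ-fromℕ< u<v))) refl
... | tri≈ _ u≡v _ = contradiction (toℕ-injective u≡v) u≢v
... | tri> _ _ v<u = (u , fromℕ< v<u) ,
  backward (toℕ-injective (trans (toℕ-inject≤ _ (toℕ≤n u)) (toℕ-fromℕ< v<u))) refl

-- Degree and colour contributions of a single edge

same : Fin n → Fin n → ℕ
same w u = keep ⌊ w ≟ u ⌋ 1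

-- The ends are distinct, so the disjunction in `incident` becomes a sum over them. The degree
-- balance of an exchange is then a rearrangement of four summands.
incident-joins : {e : Edge n} {u v : Fin n} (w : Fin n) → Joins e u v →
  keep (incident w e) 1 ≡ same w u + same w v
incident-joins {e = e} w (forward refl refl) with w ≟ lo e | w ≟ hi e
... | yes p | yes q = contradiction (trans (sym p) q) (lo≢hi e)
... | yes _ | no _  = refl
... | no _  | yes _ = refl
... | no _  | no _  = refl
incident-joins {e = e} w (backward refl refl) with w ≟ lo e | w ≟ hi e
... | yes p | yes q = contradiction (trans (sym p) q) (lo≢hi e)
... | yes _ | no _  = refl
... | no _  | yes _ = refl
... | no _  | no _  = refl

joins⇒incident : {e : Edge n} {u v : Fin n} → Joins e u v → incident u e ≡ true
joins⇒incident {e = e} (forward refl refl) with lo e ≟ lo e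
... | yes _ = refl
... | no ¬p = contradiction refl ¬p
joins⇒incident {e = e} (backward refl refl) with hi e ≟ lo e | hi e ≟ hi e
... | yes _ | _     = refl
... | no _  | yes _ = refl
... | no _  | no ¬p = contradiction refl ¬p

incident⇒joins : {e : Edge n} {u : Fin n} → incident u e ≡ true → ∃[ v ] Joins e u v
incident⇒joins {e = e} {u} inc with u ≟ lo e | u ≟ hi e
... | yes p | _     = hi e , forward (sym p) refl
... | no _  | yes q = lo e , backward refl (sym q)

-- This is `colourRow` as a function of the two end colours alone, which makes its symmetry
-- available for edges in either orientation.
pairRow : Fin k → Fin k → Fin k → Fin k → Bool
pairRow i j p q = (⌊ p ≟ i ⌋ ∧ ⌊ q ≟ j ⌋) ∨ (⌊ p ≟ j ⌋ ∧ ⌊ q ≟ i ⌋)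

pairRow-sym : (i j p q : Fin k) → pairRow i j p q ≡ pairRow i j q p
pairRow-sym i j p q = trans (∨-comm (⌊ p ≟ i ⌋ ∧ ⌊ q ≟ j ⌋) _)
  (cong₂ _∨_ (∧-comm ⌊ p ≟ j ⌋ _) (∧-comm ⌊ p ≟ i ⌋ _))

colourRow-joins : (z : Fin n → Fin k) (i j : Fin k) {e : Edge n} {u v : Fin n} → Joins e u v →
  colourRow z i j e ≡ pairRow i j (z u) (z v)
colourRow-joins z i j (forward refl refl) = refl
colourRow-joins z i j {e} (backward refl refl) = pairRow-sym i j (z (lo e)) (z (hi e))

pairRow-self : (p q : Fin k) → pairRow p q p q ≡ true
pairRow-self p q with p ≟ p | q ≟ q
... | yes _ | yes _ = refl
... | no ¬p | _     = contradiction refl ¬p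
... | _     | no ¬q = contradiction refl ¬q

colourRow⇒joins : (z : Fin n → Fin k) (i j : Fin k) {e : Edge n} → colourRow z i j e ≡ true →
  ∃₂ λ u v → Joins e u v × z u ≡ i × z v ≡ j
colourRow⇒joins z i j {e} row with z (lo e) ≟ i | z (hi e) ≟ j
... | yes p | yes q = lo e , hi e , forward refl refl , p , q
... | yes _ | no _  with z (lo e) ≟ j | z (hi e) ≟ i
...   | yes p | yes q = hi e , lo e , backward refl refl , q , p
colourRow⇒joins z i j {e} row | no _ | _ with z (lo e) ≟ j | z (hi e) ≟ i
...   | yes p | yes q = hi e , lo e , backward refl refl , q , p

-- Fibers in terms of multigraphs

SameDegrees : Vecℕ n → Vecℕ n → Set
SameDegrees x y = ∀ w → mass (incident w) x ≡ mass (incident w) y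

SameColours : (Fin n → Fin k) → Vecℕ n → Vecℕ n → Set
SameColours z x y = ∀ i j → mass (colourRow z i j) x ≡ mass (colourRow z i j) y

-- Eliminates the right-hand side `b` and the integers: membership in a common fiber becomes
-- equality of counts, with colour rows for all ordered pairs.
record SameFiber (z : Fin n → Fin k) (x y : Vecℕ n) : Set where
  constructor sameFiber
  field
    degrees : SameDegrees x y
    colours : SameColours z x y
open SameFiber

sameFiber-refl : {z : Fin n → Fin k} {x : Vecℕ n} → SameFiber z x x
sameFiber-refl = sameFiber (λ _ → refl) (λ _ _ → refl)

sameFiber-sym : {z : Fin n → Fin k} {x y : Vecℕ n} → SameFiber z x y → SameFiber z y x
sameFiber-sym (sameFiber d c) = sameFiber (λ w → sym (d w)) (λ i j → sym (c i j))

sameFiber-trans : {z : Fin n → Fin k} {x y w : Vecℕ n} → SameFiber z x y → SameFiber z y w → SameFiber z x w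
sameFiber-trans (sameFiber d c) (sameFiber d′ c′) = sameFiber (λ w → trans (d w) (d′ w)) (λ i j → trans (c i j) (c′ i j))

maskedℤ-diff : (P : Edge n → Bool) (x y : Vecℕ n) →
  sumEdgeℤ n (λ e → if P e then diff x y e else + 0) ≡ + mass P x ℤ.- + mass P y
maskedℤ-diff P x y = trans (sumEdgeℤ-cong pointwise)
  (sumEdgeℤ-pos-neg (λ e → keep (P e) (x e)) (λ e → keep (P e) (y e)))
  where
  pointwise : ∀ e → (if P e then diff x y e else + 0) ≡ + keep (P e) (x e) ℤ.- + keep (P e) (y e)
  pointwise e with P e
  ... | true  = refl
  ... | false = refl

maskedℤ-cong : (P : Edge n → Bool) {γ γ′ : Vecℤ n} → γ ≗ᵥ γ′ →
  sumEdgeℤ n (λ e → if P e then γ e else + 0) ≡ sumEdgeℤ n (λ e → if P e then γ′ e else + 0)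
maskedℤ-cong P eq = sumEdgeℤ-cong λ e → cong (λ a → if P e then a else + 0) (eq e)

maskedℤ-toℤ : (P : Edge n → Bool) (x : Vecℕ n) →
  sumEdgeℤ n (λ e → if P e then toℤ x e else + 0) ≡ + mass P x
maskedℤ-toℤ {n} P x = begin
  sumEdgeℤ n (λ e → if P e then toℤ x e else + 0)
    ≡⟨ maskedℤ-cong P (λ e → sym (ℤₚ.+-identityʳ (+ x e))) ⟩
  -- The claim reduces to `maskedℤ-diff` with the zero vector subtracted.
  sumEdgeℤ n (λ e → if P e then diff x (λ _ → 0) e else + 0)
    ≡⟨ maskedℤ-diff P x (λ _ → 0) ⟩
  + mass P x ℤ.- + mass P (λ _ → 0)
    ≡⟨ cong (λ m → + mass P x ℤ.- + m)
         (sumFinℕ-zero n λ v → sumFinℕ-zero (toℕ v) λ u → keep-0 (P (v , u))) ⟩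
  + mass P x ℤ.- + 0
    ≡⟨ ℤₚ.+-identityʳ _ ⟩
  + mass P x ∎
  where open ≡-Reasoning

mass-colourRow-sym : (z : Fin n → Fin k) (x : Vecℕ n) (i j : Fin k) →
  mass (colourRow z i j) x ≡ mass (colourRow z j i) x
mass-colourRow-sym z x i j =
  sumEdgeℕ-cong λ e → cong (λ b → keep b (x e)) (∨-comm (⌊ z (lo e) ≟ i ⌋ ∧ ⌊ z (hi e) ≟ j ⌋) _)

extend-colours : (z : Fin n → Fin k) {x y : Vecℕ n} →
  (∀ i j → i Fin.≤ j → mass (colourRow z i j) x ≡ mass (colourRow z i j) y) → SameColours z x y
extend-colours z {x} {y} h i j with Finₚ.≤-total i j
... | inj₁ i≤j = h i j i≤j
... | inj₂ j≤i = trans (mass-colourRow-sym z x i j) (trans (h j i j≤i) (mass-colourRow-sym z y j i))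

fiber⇒sameFiber : {z : Fin n → Fin k} {b : RHS n k} {x y : Vecℕ n} →
  InFiber z b x → InFiber z b y → SameFiber z x y
fiber⇒sameFiber {z = z} {x = x} {y} (dx , cx) (dy , cy) =
  sameFiber (λ w → equal (incident w) (trans (dx w) (sym (dy w))))
    (extend-colours z λ i j i≤j → equal (colourRow z i j) (trans (cx i j i≤j) (sym (cy i j i≤j))))
  where
  equal : ∀ P → sumEdgeℤ _ (λ e → if P e then toℤ x e else + 0) ≡ sumEdgeℤ _ (λ e → if P e then toℤ y e else + 0) →
          mass P x ≡ mass P y
  equal P eq = ℤₚ.+-injective (trans (sym (maskedℤ-toℤ P x)) (trans eq (maskedℤ-toℤ P y)))

fiber-transport : {z : Fin n → Fin k} {b : RHS n k} {x y : Vecℕ n} →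
  SameFiber z x y → InFiber z b x → InFiber z b y
fiber-transport {z = z} {x = x} {y} (sameFiber d c) (dx , cx) =
  (λ w → trans (equal (incident w) (d w)) (dx w)) ,
  (λ i j i≤j → trans (equal (colourRow z i j) (c i j)) (cx i j i≤j))
  where
  equal : ∀ P → mass P x ≡ mass P y →
          sumEdgeℤ _ (λ e → if P e then toℤ y e else + 0) ≡ sumEdgeℤ _ (λ e → if P e then toℤ x e else + 0)
  equal P eq = trans (maskedℤ-toℤ P y) (trans (cong +_ (sym eq)) (sym (maskedℤ-toℤ P x)))

sameFiber⇒kernel : {z : Fin n → Fin k} {x y : Vecℕ n} → SameFiber z x y → InKernel z (diff x y)
sameFiber⇒kernel {z = z} {x} {y} (sameFiber d c) =
  (λ w → zero-diff (incident w) (d w)) , (λ i j _ → zero-diff (colourRow z i j) (c i j))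
  where
  zero-diff : ∀ P → mass P x ≡ mass P y → sumEdgeℤ _ (λ e → if P e then diff x y e else + 0) ≡ + 0
  zero-diff P eq = trans (maskedℤ-diff P x y) (ℤₚ.i≡j⇒i-j≡0 (cong +_ eq))

kernel⇒sameDegrees : {z : Fin n → Fin k} {x y : Vecℕ n} → InKernel z (diff x y) → SameDegrees x y
kernel⇒sameDegrees {x = x} {y} (d , _) w =
  ℤₚ.+-injective (ℤₚ.i-j≡0⇒i≡j _ _ (trans (sym (maskedℤ-diff (incident w) x y)) (d w)))

kernel-cong : {z : Fin n → Fin k} {γ γ′ : Vecℤ n} → γ ≗ᵥ γ′ → InKernel z γ → InKernel z γ′
kernel-cong {z = z} eq (d , c) =
  (λ w → trans (maskedℤ-cong (incident w) (sym ∘ eq)) (d w)) ,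
  (λ i j i≤j → trans (maskedℤ-cong (colourRow z i j) (sym ∘ eq)) (c i j i≤j))

norm₁-cong : {γ γ′ : Vecℤ n} → γ ≗ᵥ γ′ → norm₁ γ ≡ norm₁ γ′
norm₁-cong eq = sumEdgeℕ-cong λ e → cong ∣_∣ (eq e)

M-cong : {z : Fin n → Fin k} {γ γ′ : Vecℤ n} → γ ≗ᵥ γ′ → M z γ → M z γ′
M-cong {z = z} eq (ker , norm) = kernel-cong {z = z} eq ker , trans (sym (norm₁-cong eq)) norm

abstract
  -- The edge of `y` makes the degree of `b` positive in `y`, hence in `x`. This is the source of
  -- every further edge used below.
  neighbour : {x y : Vecℕ n} {e : Edge n} {b a : Fin n} → SameDegrees x y → 0 < y e → Joins e b a →
    ∃₂ λ g q → 0 < x g × Joins g b q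
  neighbour {e = e} {b} deg ye eba
    with g , inc , xg ← mass-pos (incident b) (subst (0 <_) (sym (deg b)) (pos-mass (incident b) e (joins⇒incident eba) ye))
    with q , gbq ← incident⇒joins inc = g , q , xg , gbq

-- Minimal norm of the kernel

-- An edge uv of p forces edges uw and vt of m, and uw in turn forces a further edge ws of p.
disjoint-supports : {p m : Vecℕ n} → SameDegrees p m → (∀ e → 0 < p e → 0 < m e → ⊥) →
  {e : Edge n} → 0 < p e → 2 ≤ total p × 2 ≤ total m
disjoint-supports {p = p} {m} deg disj {e} pe
  with f , w , mf , fuw ← neighbour {x = m} {p} {e} (sym ∘ deg) pe (forward refl refl)
     | g , t , mg , gvt ← neighbour {x = m} {p} {e} (sym ∘ deg) pe (backward refl refl)
  with h , s , ph , hws ← neighbour {x = p} {m} deg mf (joins-sym fuw) =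
  2≤total (joins-apart {e = e} (forward refl refl) hws (joins-≢ fuw ∘ sym) (v≢w fuw mf ∘ sym)) pe ph ,
  2≤total (joins-apart fuw gvt (lo≢hi e ∘ sym) (v≢w fuw mf)) mf mg
  where
  -- If w were v, the edge uw of m would be `e` itself, which lies in p. This inequality separates
  -- the two edges on either side.
  v≢w : ∀ {f w} → Joins f (lo e) w → 0 < m f → hi e ≢ w
  v≢w fuw mf refl = disj e pe (subst (λ d → 0 < m d) (joins-unique fuw (forward refl refl)) mf)

-- The negative part of `i` is `posPart (- i)`, so one function serves both signs.
posPart : ℤ → ℕ
posPart (+ m)    = m
posPart -[1+ m ] = 0

posPart-diff : ∀ i → i ≡ + posPart i ℤ.- + posPart (- i)
posPart-diff (+ zero)  = refl
posPart-diff (+ suc m) = cong +_ (sym (+-identityʳ (suc m)))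
posPart-diff -[1+ m ]  = refl

posPart-abs : ∀ i → ∣ i ∣ ≡ posPart i + posPart (- i)
posPart-abs (+ zero)  = refl
posPart-abs (+ suc m) = sym (+-identityʳ (suc m))
posPart-abs -[1+ m ]  = refl

posPart-disjoint : ∀ i → 0 < posPart i → 0 < posPart (- i) → ⊥
posPart-disjoint (+ suc m) _ ()

posPart-pos : ∀ i → 0 < ∣ i ∣ → 0 < posPart i ⊎ 0 < posPart (- i)
posPart-pos (+ suc m) _ = inj₁ z<s
posPart-pos -[1+ m ]  _ = inj₂ z<s

norm-minimal : {z : Fin n → Fin k} {γ : Vecℤ n} → InKernel z γ → ¬ (∀ e → γ e ≡ + 0) → 4 ≤ norm₁ γ
norm-minimal {n} {z = z} {γ} ker γ≢0 = subst (4 ≤_) (sym norm≡) (at-edge (sumEdgeℕ-pos norm>0))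
  where
  p m : Vecℕ n
  p e = posPart (γ e)
  m e = posPart (- γ e)
  deg : SameDegrees p m
  deg = kernel⇒sameDegrees {z = z} (kernel-cong {z = z} (λ e → posPart-diff (γ e)) ker)
  norm≡ : norm₁ γ ≡ total p + total m
  norm≡ = trans (sumEdgeℕ-cong λ e → posPart-abs (γ e)) (sumEdgeℕ-+ p m)
  norm>0 : 0 < norm₁ γ
  norm>0 = n≢0⇒n>0 λ eq → γ≢0 λ e →
    ℤₚ.∣i∣≡0⇒i≡0 (n≤0⇒n≡0 (subst (∣ γ e ∣ ≤_) eq (entry≤total (λ e → ∣ γ e ∣) e)))
  both : 2 ≤ total p × 2 ≤ total m → 4 ≤ total p + total m
  both (2≤p , 2≤m) = +-mono-≤ 2≤p 2≤m
  at-edge : ∃[ e ] 0 < ∣ γ e ∣ → 4 ≤ total p + total m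
  at-edge (e , pos) with posPart-pos (γ e) pos
  ... | inj₁ pe = both (disjoint-supports {p = p} {m} deg (λ f → posPart-disjoint (γ f)) {e} pe)
  ... | inj₂ me = both (swap (disjoint-supports {p = m} {p} (λ w → sym (deg w))
                               (λ f mf pf → posPart-disjoint (γ f) pf mf) {e} me))

-- Exchange moves

shift-diff : ∀ s a b → + (s + a) ℤ.- + (s + b) ≡ + a ℤ.- + b
shift-diff s a b =
  trans (ℤₚ.m-n≡m⊖n (s + a) (s + b)) (trans (ℤₚ.+-cancelˡ-⊖ s a b) (sym (ℤₚ.m-n≡m⊖n a b)))

-- The norm is only bounded, because an exchange may reproduce the old edges and pointwise equal
-- vectors must also count as moves. `totals` keeps track of the induction measure.
record Move (z : Fin n → Fin k) (x y : Vecℕ n) : Set where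
  constructor move
  field
    fiber  : SameFiber z x y
    totals : total x ≡ total y
    short  : norm₁ (diff x y) ≤ 4
open Move

move-sym : {z : Fin n → Fin k} → Symmetric (Move z)
move-sym {x = x} {y} (move fib tot norm) = move (sameFiber-sym fib) (sym tot)
  (subst (_≤ 4) (sumEdgeℕ-cong λ e → ℤₚ.∣i-j∣≡∣j-i∣ (+ x e) (+ y e)) norm)

move-≗ : {z : Fin n → Fin k} {x y : Vecℕ n} → x ≗ᵥ y → Move z x y
move-≗ {n} {z = z} eq = move
  (sameFiber (λ w → mass-cong (incident w) eq) (λ i j → mass-cong (colourRow z i j) eq))
  (mass-cong everywhere eq)
  (subst (_≤ 4) (sym (sumFinℕ-zero n λ v → sumFinℕ-zero (toℕ v) λ u →
    cong ∣_∣ (ℤₚ.i≡j⇒i-j≡0 (cong +_ (eq (v , u)))))) z≤n)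

-- The summand `r` cancels in the difference. This lifts moves between remainders back to the full
-- multigraphs.
move-⊕ : {z : Fin n → Fin k} (r : Vecℕ n) {x y : Vecℕ n} → Move z x y → Move z (r ⊕ x) (r ⊕ y)
move-⊕ {z = z} r {x} {y} (move (sameFiber d c) tot norm) = move
  (sameFiber (λ w → add (incident w) (d w)) (λ i j → add (colourRow z i j) (c i j)))
  (add everywhere tot)
  (subst (_≤ 4) (sym (sumEdgeℕ-cong λ e → cong ∣_∣ (shift-diff (r e) (x e) (y e)))) norm)
  where
  add : ∀ P → mass P x ≡ mass P y → mass P (r ⊕ x) ≡ mass P (r ⊕ y)
  add P eq = trans (mass-⊕ P r x) (trans (cong₂ _+_ refl eq) (sym (mass-⊕ P r y)))

-- Colours are matched edge by edge, degrees only for the two edges together.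
replace-two : {z : Fin n → Fin k} {x r : Vecℕ n} (f g f′ g′ : Edge n) → x ≗ᵥ (δ f ⊕ δ g ⊕ r) →
  (∀ w → keep (incident w f) 1 + keep (incident w g) 1 ≡ keep (incident w f′) 1 + keep (incident w g′) 1) →
  (∀ i j → colourRow z i j f ≡ colourRow z i j f′) → (∀ i j → colourRow z i j g ≡ colourRow z i j g′) →
  Move z x (δ f′ ⊕ δ g′ ⊕ r)
replace-two {n} {z = z} {x} {r} f g f′ g′ eq inc colf colg = move
  (sameFiber (λ w → rebalance (incident w) (inc w))
    (λ i j → rebalance (colourRow z i j) (cong₂ (λ a b → keep a 1 + keep b 1) (colf i j) (colg i j))))
  (rebalance everywhere refl) norm≤4
  where
  rebalance : ∀ P → keep (P f) 1 + keep (P g) 1 ≡ keep (P f′) 1 + keep (P g′) 1 →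
              mass P x ≡ mass P (δ f′ ⊕ δ g′ ⊕ r)
  rebalance P h = trans (mass-cong P eq)
    (trans (mass-⊕₃ P f g r) (trans (cong (_+ mass P r) h) (sym (mass-⊕₃ P f′ g′ r))))
  old new : Vecℕ n
  old = δ f ⊕ δ g
  new = δ f′ ⊕ δ g′
  -- After `r` cancels, the triangle inequality bounds the norm by the two old and two new edges.
  pointwise : ∀ e → ∣ diff x (new ⊕ r) e ∣ ≤ old e + new e
  pointwise e = subst (_≤ old e + new e) (cong ∣_∣ (sym change)) (ℤₚ.∣i-j∣≤∣i∣+∣j∣ (+ old e) (+ new e))
    where
    change : diff x (new ⊕ r) e ≡ + old e ℤ.- + new e
    change = trans (cong₂ (λ a b → + a ℤ.- + b) (trans (eq e) (+-comm (old e) (r e))) (+-comm (new e) (r e)))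
                   (shift-diff (r e) (old e) (new e))
  norm≤4 : norm₁ (diff x (new ⊕ r)) ≤ 4
  norm≤4 = ≤-trans (sumEdgeℕ-mono pointwise) (≤-reflexive
    (trans (sumEdgeℕ-+ old new) (cong₂ _+_ (two f g) (two f′ g′))))
    where
    two : (f g : Edge n) → total (δ f ⊕ δ g) ≡ 2
    two f g = trans (mass-⊕ everywhere (δ f) (δ g)) (cong₂ _+_ (mass-δ everywhere f) (mass-δ everywhere g))

abstract
  -- Replaces ac, bq by ab, cq. The conditions on a, b and on c, q exclude loops; b differing from
  -- both a and c makes the two old edges distinct.
  exchange : {z : Fin n → Fin k} {x : Vecℕ n} {f g : Edge n} {a b c q : Fin n} →
    Joins f a c → Joins g b q → z b ≡ z c → a ≢ b → b ≢ c → c ≢ q → 0 < x f → 0 < x g →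
    ∃₂ λ x′ f′ → Move z x x′ × Joins f′ a b × 0 < x′ f′
  exchange {z = z} {f = f} {g} {a} {b} {c} {q} fac gbq zb≡zc a≢b b≢c c≢q xf xg
    with f′ , f′ab ← edge a b a≢b | g′ , g′cq ← edge c q c≢q
    with r , eq ← remove₂ (joins-apart fac gbq (a≢b ∘ sym) b≢c) xf xg
    = δ f′ ⊕ δ g′ ⊕ r , f′ , replace-two f g f′ g′ eq inc colf colg , f′ab ,
      subst (λ m → 0 < m + δ g′ f′ + r f′) (sym (δ-self f′)) z<s
    where
    inc : ∀ w → keep (incident w f) 1 + keep (incident w g) 1 ≡ keep (incident w f′) 1 + keep (incident w g′) 1
    inc w = trans (cong₂ _+_ (incident-joins w fac) (incident-joins w gbq))
      (trans (interchange ℕₚ.+-commutativeSemigroup (same w a) (same w c) (same w b) (same w q))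
             (sym (cong₂ _+_ (incident-joins w f′ab) (incident-joins w g′cq))))
    colf : ∀ i j → colourRow z i j f ≡ colourRow z i j f′
    colf i j = trans (colourRow-joins z i j fac)
      (trans (cong (pairRow i j (z a)) (sym zb≡zc)) (sym (colourRow-joins z i j f′ab)))
    colg : ∀ i j → colourRow z i j g ≡ colourRow z i j g′
    colg i j = trans (colourRow-joins z i j gbq)
      (trans (cong (λ p → pairRow i j p (z q)) zb≡zc) (sym (colourRow-joins z i j g′cq)))

-- Connectivity

-- Both sides may move, since an exchange blocked in one multigraph is carried out in the other.
record Meet (z : Fin n → Fin k) (x y : Vecℕ n) : Set where
  constructor meeting
  field
    {x′ y′} : Vecℕ n
    common  : Edge n
    movesˡ  : Star (Move z) x x′
    movesʳ  : Star (Move z) y y′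
    inˡ     : 0 < x′ common
    inʳ     : 0 < y′ common

meet-moveˡ : {z : Fin n → Fin k} {x x′ y : Vecℕ n} → Move z x x′ → Meet z x′ y → Meet z x y
meet-moveˡ m (meeting e xs ys xe ye) = meeting e (m ◅ xs) ys xe ye

meet-moveʳ : {z : Fin n → Fin k} {x y y′ : Vecℕ n} → Move z y y′ → Meet z x y′ → Meet z x y
meet-moveʳ m (meeting e xs ys xe ye) = meeting e xs (m ◅ ys) xe ye

meet-at : {z : Fin n → Fin k} {x y : Vecℕ n} {f e : Edge n} {u v : Fin n} →
  Joins f u v → Joins e u v → 0 < x f → 0 < y e → Meet z x y
meet-at fuv euv xf ye with refl ← joins-unique fuv euv = meeting _ ε ε xf ye

meet-adjacent : {z : Fin n → Fin k} {x y : Vecℕ n} {e f : Edge n} {a b b′ : Fin n} → SameDegrees x y →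
  Joins e a b → Joins f a b′ → z b ≡ z b′ → 0 < y e → 0 < x f → Meet z x y
meet-adjacent {z = z} {x} {y} {b = b} {b′} deg eab fab′ zb≡zb′ ye xf with b ≟ b′
... | yes refl = meet-at fab′ eab xf ye
... | no b≢b′ with g , q , xg , gbq ← neighbour {x = x} {y} deg ye (joins-sym eab) with q ≟ b′
-- In `x`, ab′ and bq become ab and b′q.
...   | no q≢b′ with x′ , f′ , m , f′ab , x′f′ ← exchange {z = z} {x} fab′ gbq zb≡zb′ (joins-≢ eab) b≢b′ (q≢b′ ∘ sym) xf xg =
  meet-moveˡ m (meet-at f′ab eab x′f′ ye)
-- Here `x` contains bb′, and that exchange would create a loop at b′. An edge b′r of `y` is either
-- bb′ too, or lets ab, b′r become ab′, br in `y`.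
...   | yes refl with h , r , yh , hb′r ← neighbour {x = y} {x} (sym ∘ deg) xf (joins-sym fab′) with r ≟ b
...     | yes refl = meet-at gbq (joins-sym hb′r) xg yh
...     | no r≢b with y′ , e′ , m , e′ab′ , y′e′ ←
                      exchange {z = z} {y} eab hb′r (sym zb≡zb′) (joins-≢ fab′) (b≢b′ ∘ sym) (r≢b ∘ sym) ye yh =
  meet-moveʳ m (meet-at fab′ e′ab′ xf y′e′)

meet : {z : Fin n → Fin k} {x y : Vecℕ n} {e : Edge n} {a b : Fin n} → SameFiber z x y →
  Joins e a b → 0 < y e → Meet z x y
meet {z = z} {x} {y} {e} {a} {b} (sameFiber deg col) eab ye
  with f , row , xf ← mass-pos (colourRow z (z a) (z b)) (subst (0 <_) (sym (col (z a) (z b)))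
         (pos-mass (colourRow z (z a) (z b)) e (trans (colourRow-joins z _ _ eab) (pairRow-self (z a) (z b))) ye))
  with a′ , b′ , fa′b′ , za′≡za , zb′≡zb ← colourRow⇒joins z (z a) (z b) row
  with a′ ≟ a | b′ ≟ a | a′ ≟ b
... | yes refl | _ | _ = meet-adjacent {z = z} {x} {y} deg eab fa′b′ (sym zb′≡zb) ye xf
-- When a′b′ meets ab crosswise, the shared vertex has both colours, so all the ends have one colour
-- and the hypothesis of `meet-adjacent` holds.
... | no _ | yes refl | _ =
  meet-adjacent {z = z} {x} {y} deg eab (joins-sym fa′b′) (trans (sym zb′≡zb) (sym za′≡za)) ye xf
... | no _ | no _ | yes refl =
  meet-adjacent {z = z} {x} {y} deg (joins-sym eab) fa′b′ (trans (sym za′≡za) (sym zb′≡zb)) ye xf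
... | no a′≢a | no b′≢a | no a′≢b with g , p , xg , gap ← neighbour {x = x} {y} deg ye eab with p ≟ a′
-- In `x`, b′a′ and ap become b′a and a′p, so `x′` and `y` have edges meeting at a. The case b′ = b
-- is included.
...   | no p≢a′ with x′ , f′ , m , f′b′a , x′f′ ←
                  exchange {z = z} {x} (joins-sym fa′b′) gap (sym za′≡za) b′≢a (a′≢a ∘ sym) (p≢a′ ∘ sym) xf xg =
  meet-moveˡ m (meet-adjacent {z = z} {x′} {y}
    (λ w → trans (sym (degrees (fiber m) w)) (deg w)) eab (joins-sym f′b′a) (sym zb′≡zb) ye x′f′)
-- Now `x` contains aa′. An edge a′r of `y` is either aa′ too, or lets ba, a′r become ba′, ar in
-- `y`, giving edges that meet at a′.
...   | yes refl with h , r , yh , ha′r ← neighbour {x = y} {x} (sym ∘ deg) xf fa′b′ with r ≟ a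
...     | yes refl = meet-at gap (joins-sym ha′r) xg yh
...     | no r≢a with y′ , e′ , m , e′ba′ , y′e′ ←
                      exchange {z = z} {y} (joins-sym eab) ha′r za′≡za (a′≢b ∘ sym) a′≢a (r≢a ∘ sym) ye yh =
  meet-moveʳ m (meet-adjacent {z = z} {x} {y′}
    (λ w → trans (deg w) (degrees (fiber m) w)) (joins-sym e′ba′) fa′b′ (sym zb′≡zb) y′e′ xf)

moves-invariant : {z : Fin n → Fin k} {x y : Vecℕ n} → Star (Move z) x y → SameFiber z x y × total x ≡ total y
moves-invariant ε = sameFiber-refl , refl
moves-invariant (m ◅ ms) with fib , tot ← moves-invariant ms =
  sameFiber-trans (fiber m) fib , trans (totals m) tot

cancel-edge : {z : Fin n → Fin k} {x y r s : Vecℕ n} {e : Edge n} → x ≗ᵥ (δ e ⊕ r) → y ≗ᵥ (δ e ⊕ s) →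
  SameFiber z x y → SameFiber z r s
cancel-edge {z = z} {x} {y} {r} {s} {e} x≗ y≗ (sameFiber d c) =
  sameFiber (λ w → cancel (incident w) (d w)) (λ i j → cancel (colourRow z i j) (c i j))
  where
  cancel : ∀ P → mass P x ≡ mass P y → mass P r ≡ mass P s
  cancel P eq = +-cancelˡ-≡ (keep (P e) 1) _ _
    (trans (sym (mass-remove P e x≗)) (trans eq (mass-remove P e y≗)))

connected : (z : Fin n → Fin k) (N : ℕ) (x y : Vecℕ n) → total y ≡ N → SameFiber z x y → Star (Move z) x y
connected z zero x y tot (sameFiber deg col) = move-≗ x≗y ◅ ε
  where
  y≡0 : ∀ e → y e ≡ 0
  y≡0 e = n≤0⇒n≡0 (subst (y e ≤_) tot (entry≤total y e))
  x≡0 : ∀ e → x e ≡ 0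
  x≡0 e with x e in eq
  ... | zero  = refl
  -- An edge of `x` would force an edge of the empty `y` at the same vertex.
  ... | suc _ with g , _ , yg , _ ← neighbour {x = y} {x} {e} (sym ∘ deg) (subst (0 <_) (sym eq) z<s) (forward refl refl) =
    contradiction (y≡0 g) (ℕₚ.>⇒≢ yg)
  x≗y : x ≗ᵥ y
  x≗y e = trans (x≡0 e) (sym (y≡0 e))
connected z (suc N) x y tot fib
  with e , ye ← sumEdgeℕ-pos {x = y} (subst (0 <_) (sym tot) z<s)
  with meeting {x′} {y′} f xs ys x′f y′f ← meet {x = x} {e = e} fib (forward refl refl) ye
  with r , x′≗ ← remove {x = x′} f x′f | s , y′≗ ← remove {x = y′} f y′f
  with fibˣ , _ ← moves-invariant xs | fibʸ , totʸ ← moves-invariant ys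
  -- The path runs from `x` to `x′`, through the remainders `r` and `s` with the common edge put
  -- back, to `y′`, and along the reversed moves to `y`.
  = xs ◅◅ move-≗ x′≗
    ◅ gmap (δ f ⊕_) (move-⊕ (δ f)) (connected z N r s tot-s fib-rs)
    ◅◅ move-≗ (sym ∘ y′≗) ◅ reverse move-sym ys
  where
  tot-s : total s ≡ N
  tot-s = suc-injective (trans (sym (mass-remove everywhere f y′≗)) (trans (sym totʸ) tot))
  fib-rs : SameFiber z r s
  fib-rs = cancel-edge x′≗ y′≗ (sameFiber-trans (sameFiber-sym fibˣ) (sameFiber-trans fib fibʸ))

-- From moves to walks in a fiber

walk-respˡ : {z : Fin n → Fin k} {b : RHS n k} {x x′ y : Vecℕ n} → x ≗ᵥ x′ → Walk z b (M z) x′ y → Walk z b (M z) x y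
walk-respˡ eq (here eq′) = here λ e → trans (eq e) (eq′ e)
walk-respˡ {z = z} {x = x} {x′} eq (step {y = w} fib adj walk) = step fib (adj′ adj) walk
  where
  diff≗ : diff x′ w ≗ᵥ diff x w
  diff≗ e = cong (λ m → + m ℤ.- + w e) (sym (eq e))
  adj′ : Adjacent (M z) x′ w → Adjacent (M z) x w
  adj′ (inj₁ m) = inj₁ (M-cong {z = z} diff≗ m)
  adj′ (inj₂ m) = inj₂ (M-cong {z = z} (λ e → cong -_ (diff≗ e)) m)

-- A move of norm 4 is an element of `M z`. A shorter one has difference zero by `norm-minimal`, so
-- it is dropped and the walk restarts from a pointwise equal vector.
moves⇒walk : {z : Fin n → Fin k} {b : RHS n k} {x y : Vecℕ n} → InFiber z b x → Star (Move z) x y → Walk z b (M z) x y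
moves⇒walk fx ε = here λ _ → refl
moves⇒walk {z = z} {b} {x} fx (_◅_ {j = w} (move fib _ norm≤4) ms)
  with walk ← moves⇒walk {z = z} {b} (fiber-transport {z = z} {b} {x} {w} fib fx) ms
  with norm₁ (diff x w) ℕₚ.≟ 4
... | yes norm≡4 = step (fiber-transport {z = z} {b} {x} {w} fib fx) (inj₁ (sameFiber⇒kernel {z = z} fib , norm≡4)) walk
... | no norm≢4 = walk-respˡ x≗w walk
  where
  norm≱4 : ¬ 4 ≤ norm₁ (diff x w)
  norm≱4 4≤norm = norm≢4 (ℕₚ.≤-antisym norm≤4 4≤norm)
  x≗w : x ≗ᵥ w
  x≗w e with x e ℕₚ.≟ w e
  ... | yes eq = eq
  ... | no neq = contradiction
    (norm-minimal {z = z} (sameFiber⇒kernel {z = z} fib) λ z≡0 → neq (ℤₚ.+-injective (ℤₚ.i-j≡0⇒i≡j _ _ (z≡0 e))))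
    norm≱4

-- Finiteness

-- The codomain depends on the index because the rows of an edge vector have different lengths.
functions : ∀ m {A : Fin m → Set} → (∀ i → List (A i)) → List (∀ i → A i)
functions zero    choices = (λ ()) ∷ []
functions (suc m) {A} choices = cartesianProductWith cons (choices Fin.zero) (functions m (choices ∘ Fin.suc))
  where
  cons : A Fin.zero → (∀ i → A (Fin.suc i)) → ∀ i → A i
  cons a f Fin.zero    = a
  cons a f (Fin.suc i) = f i

-- Listed functions match only up to a pointwise relation `R`, as functions are not compared by
-- propositional equality. Taking `R` itself pointwise allows the nested use in `∈-box`.
functions-complete : ∀ m {A : Fin m → Set} (choices : ∀ i → List (A i)) (R : ∀ i → A i → Set) →
  (∀ i → ∃[ a ] a ∈ choices i × R i a) → ∃[ f ] f ∈ functions m choices × (∀ i → R i (f i))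
functions-complete zero    choices R h = _ , here refl , λ ()
functions-complete (suc m) choices R h
  with a , a∈ , ra ← h Fin.zero
  with f , f∈ , rf ← functions-complete m (choices ∘ Fin.suc) (λ i → R (Fin.suc i)) (h ∘ Fin.suc)
  = _ , ∈-cartesianProductWith⁺ _ a∈ f∈ , λ { Fin.zero → ra ; (Fin.suc i) → rf i }

interval : ℕ → List ℤ
-- `upTo` excludes its bound, hence the successor.
interval N = map +_ (upTo (suc N)) ++ map (λ m → - + m) (upTo (suc N))

∈-interval : ∀ {N} i → ∣ i ∣ ≤ N → i ∈ interval N
∈-interval     (+ m)    le = ∈-++⁺ˡ (∈-map⁺ +_ (∈-upTo⁺ (s≤s le)))
∈-interval {N} -[1+ m ] le = ∈-++⁺ʳ (map +_ (upTo (suc N))) (∈-map⁺ (λ m → - + m) (∈-upTo⁺ (s≤s le)))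

box : ∀ n → ℕ → List (Vecℤ n)
box n N = map (λ f (v , u) → f v u) (functions n λ v → functions (toℕ v) λ _ → interval N)

∈-box : {N : ℕ} (γ : Vecℤ n) → (∀ e → ∣ γ e ∣ ≤ N) → ∃[ γ′ ] γ′ ∈ box n N × γ ≗ᵥ γ′
∈-box {n} {N} γ le
  with f , f∈ , γ≗f ← functions-complete n (λ v → functions (toℕ v) λ _ → interval N)
         (λ v g → ∀ u → γ (v , u) ≡ g u)
         (λ v → functions-complete (toℕ v) (λ _ → interval N) (λ u i → γ (v , u) ≡ i)
           (λ u → γ (v , u) , ∈-interval (γ (v , u)) (le (v , u)) , refl))
  = _ , ∈-map⁺ _ f∈ , λ (v , u) → γ≗f v u

M? : (z : Fin n → Fin k) → Decidable (M z)
M? z γ =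
  (all? (λ w → Dmul γ w ℤ.≟ + 0) ×-dec all? (λ i → all? λ j → (i Finₚ.≤? j) →-dec (Cmul z γ i j ℤ.≟ + 0)))
  ×-dec (norm₁ γ ℕₚ.≟ 4)

-- Norm 4 bounds each entry by 4 in absolute value, so a finite box contains all candidates up to
-- pointwise equality, and `M?` selects among them.
M-finite : (z : Fin n → Fin k) → FiniteVSet (M z)
M-finite {n} z = filter (M? z) (box n 4) , λ γ → covered γ , sound γ
  where
  covered : ∀ γ → M z γ → ∃[ γ′ ] γ′ ∈ filter (M? z) (box n 4) × γ ≗ᵥ γ′
  covered γ mγ with γ′ , γ′∈ , eq ← ∈-box γ (λ e → subst (∣ γ e ∣ ≤_) (proj₂ mγ) (entry≤total (λ e → ∣ γ e ∣) e)) =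
    γ′ , ∈-filter⁺ (M? z) γ′∈ (M-cong {z = z} eq mγ) , eq
  sound : ∀ γ γ′ → γ′ ∈ filter (M? z) (box n 4) → γ ≗ᵥ γ′ → M z γ
  sound γ γ′ γ′∈ eq = M-cong {z = z} (sym ∘ eq) (proj₂ (∈-filter⁻ (M? z) {xs = box n 4} γ′∈))

theorem1p1 : (n k : ℕ) → .{{_ : NonZero n}} → .{{_ : NonZero k}} → (z : Fin n → Fin k) →
    IsMarkovBasis z (M z) ×
    (∀ (γ : Vecℤ n) → InKernel z γ → ¬ (∀ e → γ e ≡ + 0) → 4 ≤ norm₁ γ)
theorem1p1 n k z =
  (M-finite z , (λ _ → proj₁) ,
   (λ b x y fx fy → moves⇒walk {z = z} {b} fx
     (connected z (total y) x y refl (fiber⇒sameFiber {z = z} {b} {x} {y} fx fy)))) ,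
  (λ _ → norm-minimal {z = z})
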